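{- Let $C$ and $C'$ be Euler systems of a 4-regular multigraph $F$, and let $P$ be the circuit partition of $F$ described by: (a) at every vertex where $C$ and $C'$ involve the same transition, $P$ involves the same transition; and (b) at every vertex where $C$ and $C'$ involve two different transitions, $P$ involves the third transition. Then, over $GF(2)$, $$\mathcal{I}_{P}(C)=\mathcal{I}_{C'}(C)\cdot\mathcal{I}_{P}(C').$$
   Context: Multigraphs are finite; in a 4-regular multigraph every vertex has degree 4, and loops and parallel edges are allowed (a loop contributes 2 to the degree of its vertex). Each edge consists of two half-edges, so exactly four half-edges are incident at each vertex. A transition at a vertex $v$ is one of the three ways to sort the four half-edges at $v$ into two disjoint pairs. A circuit is a closed walk with no repeated edge; circuits are considered without preferred starting point or orientation. Choosing one transition at each vertex of $F$ yields a partition of the edge set $E(F)$ into edge-disjoint circuits (consecutive half-edges of a circuit passing through a vertex are those paired by the chosen transition); such a partition, together with its transitions, is a circuit partition $P$ of $F$, and $P$ is said to involve the chosen transition at each vertex. An Euler system is a circuit partition containing exactly one circuit (an Euler circuit, containing every edge of the component) for each connected component of $F$. Interlacement: given an Euler system $C$, two vertices $v\neq w$ are interlaced with respect to $C$ if they appear in the order $v\ldots w\ldots v\ldots w$ on one of the circuits of $C$. The interlacement matrix $\mathcal{I}(C)$ is the $V(F)\times V(F)$ zero-diagonal symmetric matrix over $GF(2)$ whose $vw$ entry ($v\neq w$) is $1$ if and only if $v$ and $w$ are interlaced with respect to $C$. Transition labels with respect to $C$: at a vertex $v$, orient the circuit of $C$ incident at $v$ (either way). The transition followed by $C$ at $v$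 is labeled $\phi$; the other transition in which in-directed half-edges are paired with out-directed half-edges is labeled $\chi$; the transition in which the two in-directed half-edges are paired with each other and the two out-directed half-edges are paired with each other is labeled $\psi$. Relative interlacement matrix: for a circuit partition $P$ (for instance an Euler system) and an Euler system $C$ of $F$, $\mathcal{I}_P(C)$ is obtained from $\mathcal{I}(C)$ as follows, all labels being with respect to $C$. If $P$ involves the $\phi$ transition at $v$, change every nonzero entry of the row and column corresponding to $v$ to $0$, and change the diagonal entry of $v$ from $0$ to $1$. If $P$ involves the $\psi$ transition at $v$, change the diagonal entry of $v$ from $0$ to $1$. (No change on account of vertices where $P$ involves the $\chi$ transition.) -}

module Defs where

open import Algebra.Bundles using (CommutativeRing)
import Algebra.Properties.Semiring.Sum as SemiringSum
open import Data.Bool.Base using (Bool; if_then_else_; _∨_)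
open import Data.Bool.Properties using (xor-∧-commutativeRing)
open import Data.Fin.Base using (Fin; toℕ; combine)
open import Data.Fin.Patterns using (0F; 1F; 2F; 3F)
open import Data.Fin.Properties
  using (any?; all?; combine-injective; injective⇒≤; toℕ<n; toℕ-injective)
  renaming (_≟_ to _≟ᶠ_)
open import Data.Nat.Base using (ℕ; zero; suc; _*_; _≤_; _<_; s≤s)
open import Data.Nat.Properties using (anyUpTo?; allUpTo?; _<?_; <-cmp)
open import Data.Product using (∃!)
open import Data.Product.Base using (∃; _×_; _,_; proj₁; proj₂; uncurry)
open import Data.Product.Properties using (≡-dec)
open import Data.Sum.Base using (_⊎_; inj₁)
open import Function.Base using (_∘_)
open import Function.Bundles using (_⇔_)
open import Function.Definitions using (Injective)
open import Relation.Binary.Construct.Closure.ReflexiveTransitive using (Star)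
open import Relation.Binary.Definitions using (DecidableEquality; tri<; tri≈; tri>)
open import Relation.Binary.PropositionalEquality
  using (_≡_; _≢_; refl; sym; cong₂)
open import Relation.Nullary.Decidable
  using (Dec; yes; no; does; map′; ¬?; _×-dec_; _⊎-dec_; _→-dec_)
open import Relation.Nullary.Negation using (¬_; contradiction)

module GF2 = CommutativeRing xor-∧-commutativeRing
open SemiringSum GF2.semiring public using (sum)

Matrix : ℕ → Set
Matrix n = Fin n → Fin n → GF2.Carrier

infix  4 _≋_
infixl 7 _⊗_

_≋_ : ∀ {n} → Matrix n → Matrix n → Set
A ≋ B = ∀ v w → A v w ≡ B v w

_⊗_ : ∀ {n} → Matrix n → Matrix n → Matrix n
(A ⊗ B) v w = sum (λ u → A v u GF2.* B u w)

-- The four half-edges at v are (v , 0F), …, (v , 3F); this numbering carries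
-- no meaning.  The edges are the pairs {x , mate x}, so a loop is an edge with
-- both half-edges at one vertex, and parallel edges are allowed.
record FourRegularMultigraph : Set where
  field
    order : ℕ

  Vertex : Set
  Vertex = Fin order

  HalfEdge : Set
  HalfEdge = Vertex × Fin 4

  field
    mate            : HalfEdge → HalfEdge
    mate-involutive : ∀ x → mate (mate x) ≡ x
    mate-distinct   : ∀ x → mate x ≢ x

  vertex : HalfEdge → Vertex
  vertex = proj₁

  SameEdge : HalfEdge → HalfEdge → Set
  SameEdge x y = x ≡ y ⊎ x ≡ mate y

  Adjacent : Vertex → Vertex → Set
  Adjacent u v = ∃ λ x → vertex x ≡ u × vertex (mate x) ≡ v

  Connected : Vertex → Vertex → Set
  Connected = Star Adjacent

  _≟ᴴ_ : DecidableEquality HalfEdge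
  _≟ᴴ_ = ≡-dec _≟ᶠ_ _≟ᶠ_

  sameEdge? : ∀ x y → Dec (SameEdge x y)
  sameEdge? x y = (x ≟ᴴ y) ⊎-dec (x ≟ᴴ mate y)

data Transition : Set where
  01∣23 02∣13 03∣12 : Transition

_≟ᵀ_ : DecidableEquality Transition
01∣23 ≟ᵀ 01∣23 = yes refl
01∣23 ≟ᵀ 02∣13 = no λ ()
01∣23 ≟ᵀ 03∣12 = no λ ()
02∣13 ≟ᵀ 01∣23 = no λ ()
02∣13 ≟ᵀ 02∣13 = yes refl
02∣13 ≟ᵀ 03∣12 = no λ ()
03∣12 ≟ᵀ 01∣23 = no λ ()
03∣12 ≟ᵀ 02∣13 = no λ ()
03∣12 ≟ᵀ 03∣12 = yes refl

partner : Transition → Fin 4 → Fin 4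
partner 01∣23 0F = 1F
partner 01∣23 1F = 0F
partner 01∣23 2F = 3F
partner 01∣23 3F = 2F
partner 02∣13 0F = 2F
partner 02∣13 1F = 3F
partner 02∣13 2F = 0F
partner 02∣13 3F = 1F
partner 03∣12 0F = 3F
partner 03∣12 1F = 2F
partner 03∣12 2F = 1F
partner 03∣12 3F = 0F

data Label : Set where
  φ χ ψ : Label

module _ (F : FourRegularMultigraph) where
  open FourRegularMultigraph F

  -- A circuit partition is determined by its transitions; its circuits are
  -- those singled out by IsCircuit below.
  CircuitPartition : Set
  CircuitPartition = Vertex → Transition

  module _ (C : CircuitPartition) where

    -- Leaving a vertex along x, the walk arrives at the next vertex along
    -- mate x and leaves it along the half-edge that C pairs with mate x.
    step : HalfEdge → HalfEdge
    step x = let (v , a) = mate x in v , partner (C v) a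

    walk : HalfEdge → ℕ → HalfEdge
    walk x zero    = x
    walk x (suc i) = step (walk x i)

  -- A closed walk following the transitions of a circuit partition, with a
  -- preferred start and orientation: it first leaves along the half-edge
  -- start, and it traverses length edges.
  record Route : Set where
    constructor route
    field
      start  : HalfEdge
      length : ℕ
  open Route public

  module _ (C : CircuitPartition) where

    at : Route → ℕ → HalfEdge
    at c = walk C (start c)

    Closed : Route → Set
    Closed c = at c (length c) ≡ start c

    NoRepeatedEdge : Route → Set
    NoRepeatedEdge c =
      ∀ {j} → j < length c → ∀ {i} → i < j → ¬ SameEdge (at c i) (at c j)

    IsCircuit : Route → Set
    IsCircuit c = 0 < length c × Closed c × NoRepeatedEdge c

    Traverses : Route → HalfEdge → Set
    Traverses c x = ∃ λ i → i < length c × SameEdge (at c i) x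

    -- Equality of circuits up to starting point and orientation.
    SameCircuit : Route → Route → Set
    SameCircuit c d = ∀ x → Traverses c x ⇔ Traverses d x

    IsEulerSystem : Set
    IsEulerSystem = ∀ u →
      ∃! SameCircuit λ c → IsCircuit c × Connected u (vertex (start c))

    Visits : Route → Vertex → ℕ → Set
    Visits c v i = vertex (at c i) ≡ v

    InOrder : Vertex → Vertex → Route → Set
    InOrder v w c =
      ∃ λ l → l < length c × ∃ λ k → k < l × ∃ λ j → j < k × ∃ λ i → i < j ×
      (Visits c v i × Visits c w j × Visits c v k × Visits c w l)

    Interlaced : Vertex → Vertex → Set
    Interlaced v w = ∃ λ c → IsCircuit c × InOrder v w c

    -- Half-edges that are out-directed, respectively in-directed, at their
    -- vertex when c is oriented in the direction in which it is walked.
    OutDirected InDirected : Route → HalfEdge → Set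
    OutDirected c x = ∃ λ i → i < length c × at c i ≡ x
    InDirected  c x = OutDirected c (mate x)

    IncidentTo : Vertex → Route → Set
    IncidentTo v c = ∃ λ i → i < length c × Visits c v i

    PairsInWithOut : Vertex → Transition → Route → Set
    PairsInWithOut v t c = ∀ a →
      (InDirected  c (v , a) → OutDirected c (v , partner t a)) ×
      (OutDirected c (v , a) → InDirected  c (v , partner t a))

    PairsInWithIn : Vertex → Transition → Route → Set
    PairsInWithIn v t c = ∀ a →
      (InDirected  c (v , a) → InDirected  c (v , partner t a)) ×
      (OutDirected c (v , a) → OutDirected c (v , partner t a))

    -- HasLabel v t ℓ: the transition t at v is labeled ℓ with respect to C.
    -- The existential over c chooses the orientation of the circuit at v.
    -- Meaningful only when C is an Euler system, so that this circuit is unique.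
    HasLabel : Vertex → Transition → Label → Set
    HasLabel v t φ = t ≡ C v
    HasLabel v t χ = t ≢ C v ×
      ∃ λ c → IsCircuit c × IncidentTo v c × PairsInWithOut v t c
    HasLabel v t ψ =
      ∃ λ c → IsCircuit c × IncidentTo v c × PairsInWithIn v t c

    isCircuit? : ∀ c → Dec (IsCircuit c)
    isCircuit? c =
      (0 <? length c) ×-dec (at c (length c) ≟ᴴ start c) ×-dec
      allUpTo? (λ j → allUpTo? (λ i → ¬? (sameEdge? (at c i) (at c j))) j) (length c)

    noRepeatedEdge⇒length≤ : ∀ c → NoRepeatedEdge c → length c ≤ order * 4
    noRepeatedEdge⇒length≤ c simple = injective⇒≤ index-injective
      where
      index : Fin (length c) → Fin (order * 4)
      index i = uncurry combine (at c (toℕ i))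

      index-injective : Injective _≡_ _≡_ index
      index-injective {i} {j} eq with combine-injective _ _ _ _ eq
      ... | v≡ , a≡ with <-cmp (toℕ i) (toℕ j)
      ...   | tri< i<j _ _ = contradiction (inj₁ (cong₂ _,_ v≡ a≡)) (simple (toℕ<n j) i<j)
      ...   | tri≈ _ i≡j _ = toℕ-injective i≡j
      ...   | tri> _ _ j<i =
        contradiction (inj₁ (cong₂ _,_ (sym v≡) (sym a≡))) (simple (toℕ<n i) j<i)

    anyCircuit? : ∀ {Q : Route → Set} → (∀ c → Dec (Q c)) →
                  Dec (∃ λ c → IsCircuit c × Q c)
    anyCircuit? Q? = map′
      (λ (v , a , k , _ , circ , q) → route (v , a) k , circ , q)
      (λ (c , circ , q) → proj₁ (start c) , proj₂ (start c) , length c ,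
        s≤s (noRepeatedEdge⇒length≤ c (proj₂ (proj₂ circ))) , circ , q)
      (any? λ v → any? λ a → anyUpTo?
        (λ k → isCircuit? (route (v , a) k) ×-dec Q? (route (v , a) k))
        (suc (order * 4)))

    inOrder? : ∀ v w c → Dec (InOrder v w c)
    inOrder? v w c =
      anyUpTo? (λ l → anyUpTo? (λ k → anyUpTo? (λ j → anyUpTo? (λ i →
        visits? v i ×-dec visits? w j ×-dec visits? v k ×-dec visits? w l)
        j) k) l) (length c)
      where
      visits? : ∀ v i → Dec (Visits c v i)
      visits? v i = vertex (at c i) ≟ᶠ v

    interlaced? : ∀ v w → Dec (Interlaced v w)
    interlaced? v w = anyCircuit? (inOrder? v w)

    outDirected? : ∀ c x → Dec (OutDirected c x)
    outDirected? c x = anyUpTo? (λ i → at c i ≟ᴴ x) (length c)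

    inDirected? : ∀ c x → Dec (InDirected c x)
    inDirected? c = outDirected? c ∘ mate

    incidentTo? : ∀ v c → Dec (IncidentTo v c)
    incidentTo? v c = anyUpTo? (λ i → vertex (at c i) ≟ᶠ v) (length c)

    pairsInWithOut? : ∀ v t c → Dec (PairsInWithOut v t c)
    pairsInWithOut? v t c = all? λ a →
      (inDirected?  c (v , a) →-dec outDirected? c (v , partner t a)) ×-dec
      (outDirected? c (v , a) →-dec inDirected?  c (v , partner t a))

    pairsInWithIn? : ∀ v t c → Dec (PairsInWithIn v t c)
    pairsInWithIn? v t c = all? λ a →
      (inDirected?  c (v , a) →-dec inDirected?  c (v , partner t a)) ×-dec
      (outDirected? c (v , a) →-dec outDirected? c (v , partner t a))

    hasLabel? : ∀ v t ℓ → Dec (HasLabel v t ℓ)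
    hasLabel? v t φ = t ≟ᵀ C v
    hasLabel? v t χ = ¬? (t ≟ᵀ C v) ×-dec
      anyCircuit? (λ c → incidentTo? v c ×-dec pairsInWithOut? v t c)
    hasLabel? v t ψ =
      anyCircuit? (λ c → incidentTo? v c ×-dec pairsInWithIn? v t c)

    interlacementMatrix : Matrix order
    interlacementMatrix v w =
      if does (v ≟ᶠ w) then GF2.0#
      else if does (interlaced? v w) then GF2.1#
      else GF2.0#

  -- The matrix written 𝓘_P(C), with all labels taken with respect to C.
  relativeInterlacementMatrix :
    (P C : CircuitPartition) → Matrix order
  relativeInterlacementMatrix P C v w =
    if does (v ≟ᶠ w)
    then (if involves φ v ∨ involves ψ v
          then GF2.1# else interlacementMatrix C v w)
    else (if involves φ v ∨ involves φ w
          then GF2.0# else interlacementMatrix C v w)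
    where
    involves : Label → Vertex → Bool
    involves ℓ u = does (hasLabel? C u (P u) ℓ)

{-# OPTIONS --safe #-}
module Submission where

-- Let C be an Euler system and v a vertex.  The circuit of C through v visits
-- v twice, and between these visits it falls into two closed walks; half v is
-- the indicator, on half-edges, of the edges of one of them.  Over GF(2) it is
-- a cycle, that is, an even set of edges.  All that matters about it is
-- SplitsAt: along a circuit of C its value changes exactly at the visits to v.
--
-- For a cycle z, let cut z w t be the bit telling whether z separates the two
-- half-edges of a pair of the transition t at w; evenness makes this bit the
-- same for both pairs.  The alternation of the values of half v along the
-- circuits of C shows that
--   * cut (half v) w (C w) is 1 if w = v and 0 otherwise;
--   * cut (half v) v t is 1 if t is labeled ψ, and 0 if it is labeled χ
--     (ψ-label);
--   * cut (half v) w t is 1 exactly if v and w are interlaced, for w ≠ v and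
--     t ≠ C w (interlaced-cut).
-- So if P v ≠ C v, then row v of the relative interlacement matrix of P with
-- respect to C has the entries cut (half v) w (P w) (relative-row), while if
-- P v = C v, then it is a unit vector (relative-unit-row).
--
-- The product formula comes from cut-expansion: for every cycle z, the sum of z
-- and of the cycles half u over all u with cut z u (C u) = 1 is not cut by C
-- anywhere, so it is constant on each circuit of C and is cut by no transition.
-- Hence cut z w t is the sum over u of cut z u (C u) times cut (half u) w t.
--
-- This is applied to the Euler system C′ and to the cycle z that splits C at v.
-- Where C and C′ differ, so do P and C, and P and C′, so the summands are the
-- products of the matrix entries.  A vertex u where C and C′ agree contributes
-- 0 to a row v where they differ, because C does not cut z at u.  In a row
-- where C and C′ agree, all three matrices have a unit vector.

open import Defs
import Algebra.Properties.Semiring.Sum as SemiringSum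
open import Data.Bool.Base using (Bool; true; false; not; _∧_; _∨_; _xor_; if_then_else_)
open import Data.Bool.Properties
  using (∧-zeroʳ; ∧-identityʳ; ∧-distribˡ-xor; xor-same; xor-identityʳ; xor-comm; not-involutive)
open import Data.Bool.Solver using (module xor-∧-Solver)
open import Data.Fin.Base using (Fin; combine; toℕ) renaming (zero to fzero; suc to fsuc)
open import Data.Fin.Patterns using (0F; 1F; 2F; 3F)
open import Data.Fin.Properties using (all?; any?; pigeonhole; combine-injective)
  renaming (_≟_ to _≟ᶠ_; suc-injective to suc-injectiveᶠ)
open import Data.Nat.Base using (ℕ; zero; suc; _+_; _*_; _∸_; _≤_; _<_; s≤s; z≤n; z<s)
open import Data.Nat.Induction using (<-rec)
open import Data.Nat.Properties
  using (≤-refl; ≤-trans; <-trans; ≤-<-trans; <-≤-trans; <⇒≤; <⇒≢; >⇒≢; ≤∧≢⇒<; <-cmp; _<?_;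
         n<1+n; m≤n+m; m≤n⇒m≤1+n; m≤n⇒m<n∨m≡n; m∸n+n≡m; ∸-monoʳ-<; +-comm; +-suc; anyUpTo?)
open import Data.Product.Base using (∃; _×_; _,_; proj₁; proj₂)
open import Data.Sum.Base using (_⊎_; inj₁; inj₂)
open import Function.Base using (_∘_; case_of_)
open import Function.Bundles using (Equivalence)
open import Relation.Binary.Construct.Closure.ReflexiveTransitive using (ε; _◅_; _◅◅_)
open import Relation.Binary.Definitions using (tri<; tri≈; tri>)
open import Relation.Binary.PropositionalEquality
  using (_≡_; _≢_; refl; sym; trans; cong; cong₂; subst; module ≡-Reasoning)
open import Relation.Nullary.Decidable
  using (Dec; yes; no; does; map′; ¬?; _×-dec_; _⊎-dec_; _→-dec_; from-yes; dec-true; dec-false)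
open import Relation.Nullary.Negation using (¬_; contradiction)

open SemiringSum GF2.semiring using (sum-cong-≗; sum-replicate-zero; ∑-distrib-+)

-- Transitions at a single vertex

allTransitions? : {Q : Transition → Set} → (∀ t → Dec (Q t)) → Dec (∀ t → Q t)
allTransitions? Q? = map′
  (λ { (p , q , r) 01∣23 → p ; (p , q , r) 02∣13 → q ; (p , q , r) 03∣12 → r })
  (λ f → f 01∣23 , f 02∣13 , f 03∣12)
  (Q? 01∣23 ×-dec Q? 02∣13 ×-dec Q? 03∣12)

partner-involutive : ∀ t a → partner t (partner t a) ≡ a
partner-involutive = from-yes (allTransitions? λ t → all? λ a →
  partner t (partner t a) ≟ᶠ a)

partner-distinct : ∀ t a → partner t a ≢ a
partner-distinct = from-yes (allTransitions? λ t → all? λ a → ¬? (partner t a ≟ᶠ a))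

-- Distinct transitions give every half-edge distinct partners.
partner-determines : ∀ s t a → partner s a ≡ partner t a → s ≡ t
partner-determines = from-yes (allTransitions? λ s → allTransitions? λ t → all? λ a →
  (partner s a ≟ᶠ partner t a) →-dec (s ≟ᵀ t))

-- Two half-edges that t does not pair represent both pairs of t.
partner-cover : ∀ t a b c → b ≢ a → b ≢ partner t a →
                c ≡ a ⊎ c ≡ partner t a ⊎ c ≡ b ⊎ c ≡ partner t b
partner-cover = from-yes (allTransitions? λ t → all? λ a → all? λ b → all? λ c →
  ¬? (b ≟ᶠ a) →-dec (¬? (b ≟ᶠ partner t a) →-dec
  ((c ≟ᶠ a) ⊎-dec (c ≟ᶠ partner t a) ⊎-dec (c ≟ᶠ b) ⊎-dec (c ≟ᶠ partner t b))))

outside-pair : ∀ t a → ∃ λ b → b ≢ a × b ≢ partner t a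
outside-pair = from-yes (allTransitions? λ t → all? λ a → any? λ b →
  ¬? (b ≟ᶠ a) ×-dec ¬? (b ≟ᶠ partner t a))

-- The two pairs of a transition have equal sums under an even function.
even⇒pair-sum-constant : ∀ (f : Fin 4 → Bool) → sum f ≡ false →
  ∀ t a → f a xor f (partner t a) ≡ f 0F xor f (partner t 0F)
even⇒pair-sum-constant f even = λ where
    01∣23 0F → refl
    01∣23 1F → xor-comm (f 1F) (f 0F)
    01∣23 2F → up-to-sum (solve 4 (λ a b c d →
      c :+ d := (a :+ b) :+ total a b c d) refl (f 0F) (f 1F) (f 2F) (f 3F))
    01∣23 3F → up-to-sum (solve 4 (λ a b c d →
      d :+ c := (a :+ b) :+ total a b c d) refl (f 0F) (f 1F) (f 2F) (f 3F))
    02∣13 0F → refl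
    02∣13 1F → up-to-sum (solve 4 (λ a b c d →
      b :+ d := (a :+ c) :+ total a b c d) refl (f 0F) (f 1F) (f 2F) (f 3F))
    02∣13 2F → xor-comm (f 2F) (f 0F)
    02∣13 3F → up-to-sum (solve 4 (λ a b c d →
      d :+ b := (a :+ c) :+ total a b c d) refl (f 0F) (f 1F) (f 2F) (f 3F))
    03∣12 0F → refl
    03∣12 1F → up-to-sum (solve 4 (λ a b c d →
      b :+ c := (a :+ d) :+ total a b c d) refl (f 0F) (f 1F) (f 2F) (f 3F))
    03∣12 2F → up-to-sum (solve 4 (λ a b c d →
      c :+ b := (a :+ d) :+ total a b c d) refl (f 0F) (f 1F) (f 2F) (f 3F))
    03∣12 3F → xor-comm (f 3F) (f 0F)
  where
  open xor-∧-Solver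

  total : ∀ {n} → (a b c d : Polynomial n) → Polynomial n
  total a b c d = a :+ (b :+ (c :+ (d :+ con false)))

  up-to-sum : ∀ {x y} → x ≡ y xor sum f → x ≡ y
  up-to-sum {y = y} eq = trans eq (trans (cong (y xor_) even) (xor-identityʳ y))

pair-sum-constant⇒even : ∀ (f : Fin 4 → Bool) t e →
  (∀ a → f (partner t a) ≡ e xor f a) → sum f ≡ false
pair-sum-constant⇒even f 01∣23 e h rewrite h 0F | h 2F =
  solve 3 (λ a c e → a :+ ((e :+ a) :+ (c :+ ((e :+ c) :+ con false))) := con false)
    refl (f 0F) (f 2F) e
  where open xor-∧-Solver
pair-sum-constant⇒even f 02∣13 e h rewrite h 0F | h 1F =
  solve 3 (λ a b e → a :+ (b :+ ((e :+ a) :+ ((e :+ b) :+ con false))) := con false)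
    refl (f 0F) (f 1F) e
  where open xor-∧-Solver
pair-sum-constant⇒even f 03∣12 e h rewrite h 0F | h 1F =
  solve 3 (λ a b e → a :+ (b :+ ((e :+ b) :+ ((e :+ a) :+ con false))) := con false)
    refl (f 0F) (f 1F) e
  where open xor-∧-Solver

-- Natural numbers, decisions and sums over GF(2)

least : {Q : ℕ → Set} → (∀ n → Dec (Q n)) → ∀ n → Q n →
        ∃ λ m → Q m × (∀ {k} → k < m → ¬ Q k)
least {Q} Q? = <-rec (λ n → Q n → ∃ λ m → Q m × (∀ {k} → k < m → ¬ Q k)) descend
  where
  descend : ∀ n → (∀ {k} → k < n → Q k → ∃ λ m → Q m × (∀ {k} → k < m → ¬ Q k)) →
            Q n → ∃ λ m → Q m × (∀ {k} → k < m → ¬ Q k)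
  descend n smaller Qn with anyUpTo? Q? n
  ... | yes (k , k<n , Qk) = smaller k<n Qk
  ... | no none            = n , Qn , λ k<n Qk → none (_ , k<n , Qk)

does-≡ : {A : Set} {b : Bool} (a? : Dec A) → (A → b ≡ true) → (b ≡ true → A) → does a? ≡ b
does-≡ (yes a) to from = sym (to a)
does-≡ {b = false} (no ¬a) to from = refl
does-≡ {b = true}  (no ¬a) to from = contradiction (from refl) ¬a

xor-true⇒opposite : ∀ {a b} → a xor b ≡ true → b ≡ not a
xor-true⇒opposite {false} eq = eq
xor-true⇒opposite {true} {false} eq = refl

opposite⇒xor-true : ∀ {a b} → b ≡ not a → a xor b ≡ true
opposite⇒xor-true {false} refl = refl
opposite⇒xor-true {true}  refl = refl

not-≢ : ∀ {a b} → b ≡ not a → b ≢ a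
not-≢ {false} refl ()
not-≢ {true}  refl ()

if-true : ∀ {A : Set} {b} {x y : A} → b ≡ true → (if b then x else y) ≡ x
if-true refl = refl

if-false : ∀ {A : Set} {b} {x y : A} → b ≡ false → (if b then x else y) ≡ y
if-false refl = refl

if-id : ∀ b → (if b then true else false) ≡ b
if-id false = refl
if-id true  = refl

sum-zero : ∀ {n} (g : Fin n → Bool) → (∀ u → g u ≡ false) → sum g ≡ false
sum-zero {n} g zeros = trans (sum-cong-≗ zeros) (sum-replicate-zero n)

sum-single : ∀ {n} (g : Fin n → Bool) v → (∀ u → u ≢ v → g u ≡ false) → sum g ≡ g v
sum-single g fzero rest =
  trans (cong (g fzero xor_) (sum-zero (g ∘ fsuc) λ u → rest (fsuc u) λ ())) (xor-identityʳ _)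
sum-single g (fsuc v) rest = trans (cong (_xor sum (g ∘ fsuc)) (rest fzero λ ()))
  (sum-single (g ∘ fsuc) v λ u u≢v → rest (fsuc u) (u≢v ∘ suc-injectiveᶠ))

-- Cycles and their cuts

module _ (F : FourRegularMultigraph) where
  open FourRegularMultigraph F

  -- z is the indicator of a set of edges that meets every vertex in an even
  -- number of half-edges.
  record IsCycle (z : HalfEdge → Bool) : Set where
    field
      mate-invariant : ∀ x → z (mate x) ≡ z x
      even           : ∀ v → sum (λ a → z (v , a)) ≡ false

  -- The bit telling whether z separates a pair of t at v.  The pair containing
  -- 0F is used; for cycles the choice does not matter (cut-anywhere).
  cut : (HalfEdge → Bool) → Vertex → Transition → Bool
  cut z v t = z (v , 0F) xor z (v , partner t 0F)

  cut-anywhere : ∀ {z} → IsCycle z → ∀ t x →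
    z x xor z (vertex x , partner t (proj₂ x)) ≡ cut z (vertex x) t
  cut-anywhere {z} cyc t (v , a) =
    even⇒pair-sum-constant (λ b → z (v , b)) (IsCycle.even cyc v) t a

  -- Walks following a circuit partition

  module Walks (C : CircuitPartition F) where

    -- The half-edge that C pairs with the given one.  Thus step F C x reduces to
    -- across (mate x).
    across : HalfEdge → HalfEdge
    across x = vertex x , partner (C (vertex x)) (proj₂ x)

    across-involutive : ∀ x → across (across x) ≡ x
    across-involutive (v , a) = cong (v ,_) (partner-involutive (C v) a)

    across-distinct : ∀ x → across x ≢ x
    across-distinct (v , a) eq = partner-distinct (C v) a (cong proj₂ eq)

    across-sym : ∀ {x y} → x ≡ across y → y ≡ across x
    across-sym {y = y} refl = sym (across-involutive y)

    mate-sym : ∀ {x y} → x ≡ mate y → y ≡ mate x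
    mate-sym {y = y} refl = sym (mate-involutive y)

    across-cover : ∀ {x y w} → vertex y ≡ vertex x → vertex w ≡ vertex x →
                   y ≢ x → y ≢ across x →
                   w ≡ x ⊎ w ≡ across x ⊎ w ≡ y ⊎ w ≡ across y
    across-cover {v , a} {_ , b} {_ , c} refl refl y≢x y≢x′
      with partner-cover (C v) a b c (y≢x ∘ cong (v ,_)) (y≢x′ ∘ cong (v ,_))
    ... | inj₁ refl               = inj₁ refl
    ... | inj₂ (inj₁ refl)        = inj₂ (inj₁ refl)
    ... | inj₂ (inj₂ (inj₁ refl)) = inj₂ (inj₂ (inj₁ refl))
    ... | inj₂ (inj₂ (inj₂ refl)) = inj₂ (inj₂ (inj₂ refl))

    walk-+ : ∀ x i j → walk F C x (j + i) ≡ walk F C (walk F C x i) j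
    walk-+ x i zero    = refl
    walk-+ x i (suc j) = cong (step F C) (walk-+ x i j)

    step-injective : ∀ {x y} → step F C x ≡ step F C y → x ≡ y
    step-injective {x} {y} eq =
      trans (sym (mate-involutive x)) (trans (cong mate mates) (mate-involutive y))
      where
      mates : mate x ≡ mate y
      mates = trans (sym (across-involutive (mate x)))
        (trans (cong across eq) (across-involutive (mate y)))

    walk-injective : ∀ i {x y} → walk F C x i ≡ walk F C y i → x ≡ y
    walk-injective zero    eq = eq
    walk-injective (suc i) eq = walk-injective i (step-injective eq)

    -- A walk never traverses its first edge backwards.  Otherwise the walk is
    -- a palindrome, so in its middle an involution, mate or across, has a fixed
    -- point.
    walk≢mate : ∀ d x → walk F C x d ≢ mate x
    walk≢mate zero          x eq = mate-distinct x (sym eq)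
    walk≢mate (suc zero)    x eq = across-distinct (mate x) eq
    walk≢mate (suc (suc d)) x eq =
      walk≢mate d (step F C x) (mate-sym (trans (cong across (sym eq))
        (trans (across-involutive _) (cong mate split))))
      where
      split : walk F C x (suc d) ≡ walk F C (step F C x) d
      split = trans (cong (walk F C x) (+-comm 1 d)) (walk-+ x 1 d)

    walk-apart : ∀ x {i j} → i ≤ j → walk F C x i ≢ mate (walk F C x j)
    walk-apart x {i} {j} i≤j eq with j ∸ i | m∸n+n≡m i≤j
    ... | d | refl = walk≢mate d (walk F C x i) (trans (sym (walk-+ x i d)) (mate-sym eq))

    -- Two departures from one vertex never use half-edges of one pair.
    walk-unpaired : ∀ x {i j} → i < j → walk F C x i ≢ across (walk F C x j)
    walk-unpaired x {i} {suc j} (s≤s i≤j) eq =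
      walk-apart x i≤j (trans eq (across-involutive _))

    -- The walk from x is back at x after suc k steps.
    Returns : HalfEdge → ℕ → Set
    Returns x k = walk F C x (suc k) ≡ x

    repeat⇒returns : ∀ x {i j} → i < j → walk F C x i ≡ walk F C x j → Returns x (j ∸ suc i)
    repeat⇒returns x {i} {j} i<j eq with j ∸ suc i | m∸n+n≡m i<j
    ... | d | refl = walk-injective i (sym (trans eq
      (trans (cong (walk F C x) (trans (+-suc d i) (+-comm (suc d) i))) (walk-+ x (suc d) i))))

    returns : ∀ x → ∃ (Returns x)
    returns x with pigeonhole {m = order * 4} ≤-refl index
      where
      index : Fin (suc (order * 4)) → Fin (order * 4)
      index i = let (v , a) = walk F C x (toℕ i) in combine v a
    ... | i , j , i<j , same with combine-injective _ _ _ _ same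
    ...   | v≡ , a≡ = _ , repeat⇒returns x i<j (cong₂ _,_ v≡ a≡)

    first-return⇒circuit : ∀ x n → Returns x n → (∀ {k} → k < n → ¬ Returns x k) →
                           IsCircuit F C (route x (suc n))
    first-return⇒circuit x n return first = z<s , return , simple
      where
      simple : NoRepeatedEdge F C (route x (suc n))
      simple {j} (s≤s j≤n) {i} i<j (inj₁ eq) =
        first (<-≤-trans (∸-monoʳ-< {j} z<s i<j) j≤n) (repeat⇒returns x i<j eq)
      simple j<n i<j (inj₂ eq) = walk-apart x (<⇒≤ i<j) eq

    -- Every half-edge starts a circuit: the walk is periodic, and up to its first
    -- return it repeats no edge.  It is abstract because only its existence
    -- matters, not the way in which its length is found.
    abstract
      circuitFrom : ∀ x → ∃ λ n → IsCircuit F C (route x n)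
      circuitFrom x =
        let k , return        = returns x
            n , return′ , first = least (λ k → walk F C x (suc k) ≟ᴴ x) k return
        in suc n , first-return⇒circuit x n return′ first

    -- A third departure from v would use a half-edge from one of the two pairs
    -- of C v, and both of these are used up by the first two departures.
    at-most-two-visits : ∀ {v} c → NoRepeatedEdge F C c →
      ∀ {i j k} → i < j → j < k → k < length c →
      Visits F C c v i → Visits F C c v j → ¬ Visits F C c v k
    at-most-two-visits c simple i<j j<k k<n vi vj vk
      with across-cover (trans vj (sym vi)) (trans vk (sym vi))
             (λ eq → simple (<-trans j<k k<n) i<j (inj₁ (sym eq)))
             (λ eq → walk-unpaired (start c) i<j (across-sym eq))
    ... | inj₁ eq               = simple k<n (<-trans i<j j<k) (inj₁ (sym eq))
    ... | inj₂ (inj₁ eq)        = walk-unpaired (start c) (<-trans i<j j<k) (across-sym eq)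
    ... | inj₂ (inj₂ (inj₁ eq)) = simple k<n j<k (inj₁ (sym eq))
    ... | inj₂ (inj₂ (inj₂ eq)) = walk-unpaired (start c) j<k (across-sym eq)

    walk-connected : ∀ x i → Connected (vertex x) (vertex (walk F C x i))
    walk-connected x zero    = ε
    walk-connected x (suc i) = walk-connected x i ◅◅ ((walk F C x i , refl , refl) ◅ ε)

    -- Functions that alternate at v

    -- z is a function on edges that, along the circuits of C, changes its value
    -- exactly at the visits to v.  Nothing is required on circuits that miss v
    -- except that z is constant there.
    record SplitsAt (v : Vertex) (z : HalfEdge → Bool) : Set where
      field
        mate-invariant : ∀ x → z (mate x) ≡ z x
        flips          : ∀ x → vertex x ≡ v → z (across x) ≡ not (z x)
        keeps          : ∀ x → vertex x ≢ v → z (across x) ≡ z x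

    module _ {v z} (split : SplitsAt v z) where
      open SplitsAt split

      constant-between : ∀ x {i j} → i ≤ j →
        (∀ {k} → i < k → k ≤ j → vertex (walk F C x k) ≢ v) →
        z (walk F C x j) ≡ z (walk F C x i)
      constant-between x {i} {j} i≤j away with j ∸ i | m∸n+n≡m i≤j
      ... | d | refl = go d away
        where
        go : ∀ d → (∀ {k} → i < k → k ≤ d + i → vertex (walk F C x k) ≢ v) →
             z (walk F C x (d + i)) ≡ z (walk F C x i)
        go zero    away = refl
        go (suc d) away = trans
          (keeps (mate (walk F C x (d + i))) (away (s≤s (m≤n+m i d)) ≤-refl))
          (trans (mate-invariant _) (go d λ i<k k≤ → away i<k (m≤n⇒m≤1+n k≤)))

      flips-once : ∀ x {i k j} → i < k → k ≤ j → vertex (walk F C x k) ≡ v →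
        (∀ {m} → i < m → m ≤ j → m ≢ k → vertex (walk F C x m) ≢ v) →
        z (walk F C x j) ≡ not (z (walk F C x i))
      flips-once x {i} {suc k} i<k@(s≤s i≤k) k≤j vk others = trans
        (constant-between x k≤j λ k<m m≤j → others (<-trans i<k k<m) m≤j (>⇒≢ k<m))
        (trans (flips (mate (walk F C x k)) vk) (cong not (trans (mate-invariant _)
          (constant-between x i≤k λ i<m m≤k →
            others i<m (≤-trans (m≤n⇒m≤1+n m≤k) k≤j) (<⇒≢ (s≤s m≤k))))))

      visited-between : ∀ x {i j} → i ≤ j → z (walk F C x j) ≢ z (walk F C x i) →
        ∃ λ k → i < k × k ≤ j × vertex (walk F C x k) ≡ v
      visited-between x {i} {j} i≤j differ
        with anyUpTo? (λ k → (i <? k) ×-dec (vertex (walk F C x k) ≟ᶠ v)) (suc j)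
      ... | yes (k , s≤s k≤j , i<k , vk) = k , i<k , k≤j , vk
      ... | no none = contradiction
        (constant-between x i≤j λ i<k k≤j vk → none (_ , s≤s k≤j , i<k , vk)) differ

      consecutive-visits : ∀ c → NoRepeatedEdge F C c → ∀ {i k} → i < k → k < length c →
        Visits F C c v i → Visits F C c v k → z (at F C c k) ≡ not (z (at F C c i))
      consecutive-visits c simple i<k k<n vi vk = flips-once (start c) i<k ≤-refl vk
        λ i<m m≤k m≢k vm →
          at-most-two-visits c simple i<m (≤∧≢⇒< m≤k m≢k) k<n vi vm vk

      outs-differ : ∀ c → NoRepeatedEdge F C c → ∀ {x y} →
        OutDirected F C c x → OutDirected F C c y →
        vertex x ≡ v → vertex y ≡ v → x ≢ y → z x ≡ not (z y)
      outs-differ c simple (i , i<n , refl) (k , k<n , refl) vi vk x≢y with <-cmp i k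
      ... | tri< i<k _ _ =
        trans (sym (not-involutive _)) (cong not (sym (consecutive-visits c simple i<k k<n vi vk)))
      ... | tri≈ _ refl _ = contradiction refl x≢y
      ... | tri> _ _ k<i = consecutive-visits c simple k<i i<n vk vi

      splits⇒cycle : IsCycle z
      splits⇒cycle = record
        { mate-invariant = mate-invariant
        ; even = λ w → case w ≟ᶠ v of λ where
            (yes w≡v) → pair-sum-constant⇒even (λ a → z (w , a)) (C w) true
              λ a → flips (w , a) w≡v
            (no w≢v)  → pair-sum-constant⇒even (λ a → z (w , a)) (C w) false
              λ a → keeps (w , a) w≢v
        }

    -- Having arrived along mate y, the circuit leaves along across y; at the end
    -- of the list of edges this departure is the one with index 0.
    in⇒across-out : ∀ c → IsCircuit F C c → ∀ {y} → OutDirected F C c (mate y) →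
                    OutDirected F C c (across y)
    in⇒across-out c (0<n , closed , _) {y} (i , i<n , eq) with m≤n⇒m<n∨m≡n i<n
    ... | inj₁ i+1<n = suc i , i+1<n , cong across (sym (mate-sym eq))
    ... | inj₂ refl  = 0 , 0<n , trans (sym closed) (cong across (sym (mate-sym eq)))

    -- If c visits its first vertex again at time m, then the indicator of the
    -- edges traversed before time m splits at that vertex.
    split-at : ∀ c → IsCircuit F C c → ∀ {m} → 0 < m → m < length c →
      Visits F C c (vertex (start c)) m → ∃ λ z → SplitsAt (vertex (start c)) z
    split-at c (_ , _ , simple) {suc m} _ m<n vy = z , record
      { mate-invariant = λ h → does-≡ (early? (mate h)) (λ e → dec-true (early? h) (from-mate e))
          (λ eq → to-mate (early eq))
      ; flips = flips
      ; keeps = λ h h≢v → does-≡ (early? (across h))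
          (λ e → dec-true (early? h)
            (subst Early (across-involutive h) (pass (across h) h≢v e)))
          (λ eq → pass h h≢v (early eq))
      }
      where
      x y : HalfEdge
      x = start c
      y = at F C c (suc m)

      -- The edge of h is traversed before time suc m, the second visit.
      Early : HalfEdge → Set
      Early h = ∃ λ i → i < suc m × SameEdge (at F C c i) h

      early? : ∀ h → Dec (Early h)
      early? h = anyUpTo? (λ i → sameEdge? (at F C c i) h) (suc m)

      z : HalfEdge → Bool
      z h = does (early? h)

      early : ∀ {h} → z h ≡ true → Early h
      early {h} eq with early? h
      ... | yes e = e

      to-mate : ∀ {h} → Early h → Early (mate h)
      to-mate {h} (i , i<m , inj₁ eq) = i , i<m , inj₂ (trans eq (sym (mate-involutive h)))
      to-mate     (i , i<m , inj₂ eq) = i , i<m , inj₁ eq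

      from-mate : ∀ {h} → Early (mate h) → Early h
      from-mate {h} e = subst Early (mate-involutive h) (to-mate e)

      pass : ∀ h → vertex h ≢ vertex x → Early h → Early (across h)
      pass h h≢v (zero , _ , inj₁ refl) = contradiction refl h≢v
      pass h h≢v (suc i , i<m , inj₁ refl) =
        i , <-trans (n<1+n i) i<m , inj₂ (mate-sym (across-involutive _))
      pass h h≢v (i , i<m , inj₂ eq) with m≤n⇒m<n∨m≡n i<m
      ... | inj₁ i+1<m = suc i , i+1<m , inj₁ (cong across (sym (mate-sym eq)))
      ... | inj₂ refl = contradiction (trans (cong vertex (mate-sym eq)) vy) h≢v

      x-early : Early x
      x-early = 0 , z<s , inj₁ refl

      across-x-late : ¬ Early (across x)
      across-x-late (zero  , _ , inj₁ eq) = across-distinct x (sym eq)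
      across-x-late (suc i , _ , inj₁ eq) = walk-unpaired x z<s (across-sym eq)
      across-x-late (i , i<m , inj₂ eq) = simple (≤-<-trans i<m m<n) z<s
        (inj₁ (sym (trans (cong across (sym (mate-sym eq))) (across-involutive x))))

      y-late : ¬ Early y
      y-late (i , i<m , same) = simple m<n i<m same

      across-y-early : Early (across y)
      across-y-early = m , ≤-refl , inj₂ (mate-sym (across-involutive _))

      flips : ∀ h → vertex h ≡ vertex x → z (across h) ≡ not (z h)
      -- The half-edges at the vertex are x, across x, y and across y.
      flips h h≡v with across-cover {x} {y} {h} vy h≡v
        (λ eq → simple m<n z<s (inj₁ (sym eq)))
        (λ eq → walk-unpaired x z<s (across-sym eq))
      ... | inj₁ refl = trans (dec-false (early? (across x)) across-x-late)
        (cong not (sym (dec-true (early? x) x-early)))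
      ... | inj₂ (inj₁ refl) = trans (cong z (across-involutive x))
        (trans (dec-true (early? x) x-early)
          (cong not (sym (dec-false (early? (across x)) across-x-late))))
      ... | inj₂ (inj₂ (inj₁ refl)) = trans (dec-true (early? (across y)) across-y-early)
        (cong not (sym (dec-false (early? y) y-late)))
      ... | inj₂ (inj₂ (inj₂ refl)) = trans (cong z (across-involutive y))
        (trans (dec-false (early? y) y-late)
          (cong not (sym (dec-true (early? (across y)) across-y-early))))

  -- Euler systems

  module EulerSystem (C : CircuitPartition F) (euler : IsEulerSystem F C) where
    open Walks C

    -- By uniqueness, c traverses the same edges as the circuit from y.
    traverses : ∀ {u} c → IsCircuit F C c → Connected u (vertex (start c)) →
                ∀ y → Connected u (vertex y) → Traverses F C c y
    traverses {u} c circ u~c y u~y with euler u | circuitFrom y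
    ... | _ , _ , unique | n , circ′@(0<n , _) =
      Equivalence.to (unique (circ , u~c) y)
        (Equivalence.from (unique {route y n} (circ′ , u~y) y) (0 , 0<n , inj₁ refl))

    out-or-across-out : ∀ c → IsCircuit F C c → ∀ {y} → Traverses F C c y →
                        OutDirected F C c y ⊎ OutDirected F C c (across y)
    out-or-across-out c circ (i , i<n , inj₁ eq) = inj₁ (i , i<n , eq)
    out-or-across-out c circ (i , i<n , inj₂ eq) = inj₂ (in⇒across-out c circ (i , i<n , eq))

    -- The circuit also traverses the edge of a half-edge b outside the pair of
    -- its start, so it leaves along b or along the partner of b.
    second-visit : ∀ c → IsCircuit F C c →
      ∃ λ m → 0 < m × m < length c × Visits F C c (vertex (start c)) m
    second-visit c circ = find (outside-pair (C v) a)
      where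
      v = proj₁ (start c)
      a = proj₂ (start c)

      find : (∃ λ b → b ≢ a × b ≢ partner (C v) a) →
             ∃ λ m → 0 < m × m < length c × Visits F C c v m
      find (b , b≢a , b≢a′) = visit (out-or-across-out c circ (traverses c circ ε (v , b) ε))
        where
        visit : OutDirected F C c (v , b) ⊎ OutDirected F C c (across (v , b)) →
                ∃ λ m → 0 < m × m < length c × Visits F C c v m
        visit (inj₁ (zero  , _ , eq))   = contradiction (cong proj₂ (sym eq)) b≢a
        visit (inj₁ (suc m , m<n , eq)) = suc m , z<s , m<n , cong vertex eq
        visit (inj₂ (zero  , _ , eq))   = contradiction (cong proj₂ (across-sym eq)) b≢a′
        visit (inj₂ (suc m , m<n , eq)) = suc m , z<s , m<n , cong vertex eq

    -- Abstract for the same reason as circuitFrom.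
    abstract
      split : ∀ v → ∃ (SplitsAt v)
      split v = let n , circ = circuitFrom (v , 0F)
                    _ , 0<m , m<n , vm = second-visit (route (v , 0F) n) circ
                in split-at (route (v , 0F) n) circ 0<m m<n vm

    -- The fundamental cycle of v: one of the two closed walks into which the
    -- circuit of C through v is split at v.
    half : Vertex → HalfEdge → Bool
    half v = proj₁ (split v)

    half-splits : ∀ v → SplitsAt v (half v)
    half-splits v = proj₂ (split v)

    cut-away : ∀ v w → w ≢ v → cut (half v) w (C w) ≡ false
    cut-away v w w≢v = trans
      (cong (half v (w , 0F) xor_) (SplitsAt.keeps (half-splits v) (w , 0F) w≢v)) (xor-same (half v (w , 0F)))

    partner≢across : ∀ {t} x → t ≢ C (vertex x) → (vertex x , partner t (proj₂ x)) ≢ across x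
    partner≢across {t} x t≢ eq = t≢ (partner-determines t _ (proj₂ x) (cong proj₂ eq))

    module _ {v z} (splits : SplitsAt v z) where
      open SplitsAt splits

      -- The two departures from v carry different values of z, and so do the two
      -- half-edges of each pair of C v.  So the half-edges with equal values are
      -- one departure and the arrival that precedes the other, and the pairs of
      -- the ψ transition are those with different values that C v does not form.
      ψ-label : ∀ t → t ≢ C v → does (hasLabel? F C v t ψ) ≡ cut z v t
      ψ-label t t≢C = does-≡ (hasLabel? F C v t ψ) label⇒cut cut⇒label
        where
        label⇒cut : HasLabel F C v t ψ → cut z v t ≡ true
        label⇒cut (c , (_ , _ , simple) , (i , i<n , refl) , pairs) =
          trans (sym (cut-anywhere (splits⇒cycle splits) t x))
            (opposite⇒xor-true (outs-differ splits c simple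
              (proj₂ (pairs (proj₂ x)) (i , i<n , refl)) (i , i<n , refl) refl refl
              (partner-distinct t (proj₂ x) ∘ cong proj₂)))
          where x = at F C c i

        cut⇒label : cut z v t ≡ true → HasLabel F C v t ψ
        cut⇒label crossed with circuitFrom (v , 0F)
        ... | n , circ@(0<n , _ , simple) = c , circ , (0 , 0<n , refl) , λ a → in-in a , out-out a
          where
          c = route (v , 0F) n

          opposite : ∀ a → z (v , partner t a) ≢ z (v , a)
          opposite a = not-≢ (xor-true⇒opposite
            (trans (cut-anywhere (splits⇒cycle splits) t (v , a)) crossed))

          in-in : ∀ a → InDirected F C c (v , a) → InDirected F C c (v , partner t a)
          in-in a in-a with traverses c circ ε (v , partner t a) ε
          ... | i , i<n , inj₂ eq = i , i<n , eq
          ... | i , i<n , inj₁ eq = contradiction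
            (trans (outs-differ splits c simple (i , i<n , eq) (in⇒across-out c circ in-a)
              refl refl (partner≢across (v , a) t≢C))
              (trans (cong not (flips (v , a) refl)) (not-involutive _)))
            (opposite a)

          out-out : ∀ a → OutDirected F C c (v , a) → OutDirected F C c (v , partner t a)
          out-out a out-a with traverses c circ ε (v , partner t a) ε
          ... | i , i<n , inj₁ eq = i , i<n , eq
          ... | i , i<n , inj₂ eq = contradiction
            (sym (trans (outs-differ splits c simple out-a (in⇒across-out c circ (i , i<n , eq))
              refl refl (partner≢across (v , a) t≢C ∘ across-sym))
              (trans (cong not (flips (v , partner t a) refl)) (not-involutive _))))
            (opposite a)

      -- If c traverses the edge of h, then it also leaves the vertex of h along an
      -- edge on which z has the same value.
      visit-beside : ∀ c → IsCircuit F C c → ∀ {h} → Traverses F C c h → vertex h ≢ v →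
        ∃ λ p → p < length c × Visits F C c (vertex h) p × z (at F C c p) ≡ z h
      visit-beside c circ {h} trav h≢v with out-or-across-out c circ trav
      ... | inj₁ (p , p<n , eq) = p , p<n , cong vertex eq , cong z eq
      ... | inj₂ (p , p<n , eq) = p , p<n , cong vertex eq , trans (cong z eq) (keeps h h≢v)

      -- Away from v, z has one value on each pair of C w, so a transition other
      -- than C w is cut exactly if z differs between the two visits to w, that
      -- is, if exactly one of the two visits to v lies between them.
      interlaced-cut : ∀ w t → v ≢ w → t ≢ C w → does (interlaced? F C v w) ≡ cut z w t
      interlaced-cut w t v≢w t≢C = does-≡ (interlaced? F C v w) interlaced⇒cut cut⇒interlaced
        where
        interlaced⇒cut : Interlaced F C v w → cut z w t ≡ true
        interlaced⇒cut (c , (_ , _ , simple) ,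
          l , l<n , k , k<l , j , j<k , i , i<j , vi , refl , vk , wl) =
            trans (sym (cut-anywhere (splits⇒cycle splits) t x)) (opposite⇒xor-true z-h)
          where
          x y h : HalfEdge
          x = at F C c j
          y = at F C c l
          h = vertex x , partner t (proj₂ x)

          z-y : z y ≡ not (z x)
          z-y = flips-once splits (start c) j<k (<⇒≤ k<l) vk others
            where
            others : ∀ {m} → j < m → m ≤ l → m ≢ k → ¬ Visits F C c v m
            others {m} j<m m≤l m≢k vm with <-cmp m k
            ... | tri< m<k _ _ =
              at-most-two-visits c simple (<-trans i<j j<m) m<k (<-trans k<l l<n) vi vm vk
            ... | tri≈ _ m≡k _ = m≢k m≡k
            ... | tri> _ _ k<m =
              at-most-two-visits c simple (<-trans i<j j<k) k<m (≤-<-trans m≤l l<n) vi vk vm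

          z-across-x : z (across x) ≡ z x
          z-across-x = keeps x (v≢w ∘ sym)

          -- As h is in the pair of C w that does not contain x, it has the value of y.
          z-h : z h ≡ not (z x)
          z-h with across-cover {x} {y} {h} wl refl
                     (λ eq → not-≢ z-y (cong z eq))
                     (λ eq → not-≢ z-y (trans (cong z eq) z-across-x))
          ... | inj₁ eq = contradiction (cong proj₂ eq) (partner-distinct t (proj₂ x))
          ... | inj₂ (inj₁ eq) = contradiction eq (partner≢across x t≢C)
          ... | inj₂ (inj₂ (inj₁ eq)) = trans (cong z eq) z-y
          ... | inj₂ (inj₂ (inj₂ eq)) =
            trans (cong z eq) (trans (keeps y (v≢w ∘ sym ∘ trans (sym wl))) z-y)

        cut⇒interlaced : cut z w t ≡ true → Interlaced F C v w
        cut⇒interlaced crossed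
          with circuitFrom x | circuitFrom (v , 0F)
          where x = w , 0F
        ... | n , circ | n′ , circ′@(0<n′ , _ , simple′) = c , circ′ , ordered
          where
          x y : HalfEdge
          x = w , 0F
          y = w , partner t 0F
          c = route (v , 0F) n′

          z-y : z y ≢ z x
          z-y = not-≢ (xor-true⇒opposite crossed)

          -- As z is not constant along the circuit from x, that circuit visits v.
          meets : ∃ λ k → vertex (walk F C x k) ≡ v
          meets with traverses (route x n) circ ε y ε
          ... | i , _ , same with visited-between splits x (z≤n {i}) (z-y ∘ trans (sym (z-at same)))
            where
            z-at : SameEdge (walk F C x i) y → z (walk F C x i) ≡ z y
            z-at (inj₁ eq) = cong z eq
            z-at (inj₂ eq) = trans (cong z eq) (mate-invariant y)
          ...   | k , _ , _ , vk = k , vk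

          w~v : Connected w v
          w~v = subst (Connected w) (proj₂ meets) (walk-connected x (proj₁ meets))

          visit : ∀ a → ∃ λ p → p < n′ × Visits F C c w p × z (at F C c p) ≡ z (w , a)
          visit a = visit-beside c circ′ (traverses c circ′ w~v (w , a) ε) (v≢w ∘ sym)

          -- The circuit c starts at v, so its first visit to v has index 0, and z
          -- can differ between p and q only by a second visit in between.
          order-by : ∀ {p q} → p < q → q < n′ → Visits F C c w p → Visits F C c w q →
                     z (at F C c q) ≢ z (at F C c p) → InOrder F C v w c
          order-by {zero} _ _ wp _ _ = contradiction wp v≢w
          order-by {suc p} {q} p<q q<n wp wq differ
            with visited-between splits (v , 0F) (<⇒≤ p<q) differ
          ... | k , p<k , k≤q , vk =
            q , q<n , k , ≤∧≢⇒< k≤q (λ { refl → v≢w (trans (sym vk) wq) }) ,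
            suc p , p<k , 0 , z<s , refl , wp , vk , wq

          ordered : InOrder F C v w c
          ordered with visit 0F | visit (partner t 0F)
          ... | p , p<n , wp , zp | q , q<n , wq , zq with <-cmp p q
          ...   | tri< p<q _ _ = order-by p<q q<n wp wq
                    λ eq → z-y (trans (sym zq) (trans eq zp))
          ...   | tri≈ _ refl _ = contradiction (trans (sym zq) zp) z-y
          ...   | tri> _ _ q<p = order-by q<p p<n wq wp
                    λ eq → z-y (trans (sym zq) (trans (sym eq) zp))

    -- Rows of the relative interlacement matrix

    -- The row of v lists the cuts of half v by the transitions of P.  If P w = C w,
    -- then the cut by P w is 0 for w ≠ v, matching the zeroed column.
    relative-row : ∀ P v w → P v ≢ C v →
      relativeInterlacementMatrix F P C v w ≡ cut (half v) w (P w)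
    relative-row P v w P≢C = by-cases (v ≟ᶠ w) (P w ≟ᵀ C w)
      where
      by-cases : Dec (v ≡ w) → Dec (P w ≡ C w) →
                 relativeInterlacementMatrix F P C v w ≡ cut (half v) w (P w)
      by-cases (yes refl) _ = trans (if-true (dec-true (v ≟ᶠ v) refl))
        (trans (cong₂ (λ b m → if b then true else m)
            (cong (_∨ does (hasLabel? F C v (P v) ψ)) (dec-false (P v ≟ᵀ C v) P≢C))
            (if-true (dec-true (v ≟ᶠ v) refl)))
          (trans (if-id _) (ψ-label (half-splits v) (P v) P≢C)))
      by-cases (no v≢w) (yes P≡C) = trans (if-false (dec-false (v ≟ᶠ w) v≢w))
        (trans (if-true (cong₂ _∨_ (dec-false (P v ≟ᵀ C v) P≢C) (dec-true (P w ≟ᵀ C w) P≡C)))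
          (sym (trans (cong (cut (half v) w) P≡C) (cut-away v w (v≢w ∘ sym)))))
      by-cases (no v≢w) (no P≢C′) = trans (if-false (dec-false (v ≟ᶠ w) v≢w))
        (trans (if-false (cong₂ _∨_ (dec-false (P v ≟ᵀ C v) P≢C) (dec-false (P w ≟ᵀ C w) P≢C′)))
          (trans (if-false (dec-false (v ≟ᶠ w) v≢w))
            (trans (if-id _) (interlaced-cut (half-splits v) w (P w) v≢w P≢C′))))

    relative-unit-row : ∀ P v w → P v ≡ C v →
      relativeInterlacementMatrix F P C v w ≡ does (v ≟ᶠ w)
    relative-unit-row P v w P≡C = trans
      (cong₂ (if does (v ≟ᶠ w) then_else_)
        (if-true (cong (_∨ does (hasLabel? F C v (P v) ψ)) (dec-true (P v ≟ᵀ C v) P≡C)))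
        (if-true (cong (_∨ does (P w ≟ᵀ C w)) (dec-true (P v ≟ᵀ C v) P≡C))))
      (if-id _)

    -- Expansion of a cycle in fundamental cycles

    module _ {z} (cycle : IsCycle z) where
      coefficient : Vertex → Bool
      coefficient u = cut z u (C u)

      -- What remains of z after subtracting its expansion in the fundamental
      -- cycles; it is constant on every circuit of C.
      residue : HalfEdge → Bool
      residue x = z x xor sum (λ u → coefficient u ∧ half u x)

      residue-mate : ∀ x → residue (mate x) ≡ residue x
      residue-mate x = cong₂ _xor_ (IsCycle.mate-invariant cycle x)
        (sum-cong-≗ λ u → cong (coefficient u ∧_) (SplitsAt.mate-invariant (half-splits u) x))

      -- Passing across x changes z by the coefficient of the vertex of x, and of
      -- the fundamental cycles only that of this vertex changes.
      residue-across : ∀ x → residue (across x) ≡ residue x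
      residue-across x = trans (cong₂ _xor_ z-across sum-across)
        (solve 3 (λ a b c → (a :+ b) :+ (b :+ c) := a :+ c) refl (z x) (coefficient v) _)
        where
        open xor-∧-Solver
        v = vertex x

        -- Whether the fundamental cycle of u changes between x and across x.
        jump : Vertex → Bool
        jump u = half u x xor half u (across x)

        jump-own : jump v ≡ true
        jump-own = opposite⇒xor-true (SplitsAt.flips (half-splits v) x refl)

        jump-away : ∀ u → u ≢ v → jump u ≡ false
        jump-away u u≢v = trans
          (cong (half u x xor_) (SplitsAt.keeps (half-splits u) x (u≢v ∘ sym))) (xor-same (half u x))

        z-across : z (across x) ≡ z x xor coefficient v
        z-across = trans (solve 2 (λ a b → b := a :+ (a :+ b)) refl (z x) (z (across x)))
          (cong (z x xor_) (cut-anywhere cycle (C v) x))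

        sum-across : sum (λ u → coefficient u ∧ half u (across x)) ≡
                     coefficient v xor sum (λ u → coefficient u ∧ half u x)
        sum-across = trans
          (sum-cong-≗ λ u → solve 3 (λ a b c → a :* c := (a :* (b :+ c)) :+ (a :* b)) refl
            (coefficient u) (half u x) (half u (across x)))
          (trans (∑-distrib-+ (λ u → coefficient u ∧ jump u) (λ u → coefficient u ∧ half u x))
            (cong (_xor sum (λ u → coefficient u ∧ half u x))
              (trans (sum-single (λ u → coefficient u ∧ jump u) v
                  λ u u≢v → trans (cong (coefficient u ∧_) (jump-away u u≢v)) (∧-zeroʳ _))
                (trans (cong (coefficient v ∧_) jump-own) (∧-identityʳ _)))))

      residue-walk : ∀ x i → residue (walk F C x i) ≡ residue x
      residue-walk x zero    = refl
      residue-walk x (suc i) =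
        trans (residue-across _) (trans (residue-mate (walk F C x i)) (residue-walk x i))

      residue-constant : ∀ v a b → residue (v , b) ≡ residue (v , a)
      residue-constant v a b with circuitFrom (v , a)
      ... | n , circ with traverses (route (v , a) n) circ ε (v , b) ε
      ...   | i , _ , inj₁ eq = trans (cong residue (sym eq)) (residue-walk (v , a) i)
      ...   | i , _ , inj₂ eq = trans (sym (residue-mate (v , b)))
                (trans (cong residue (sym eq)) (residue-walk (v , a) i))

      -- The residue takes one value on all half-edges at w, so it is not cut.
      cut-expansion : ∀ w t → cut z w t ≡ sum (λ u → cut z u (C u) ∧ cut (half u) w t)
      cut-expansion w t = begin
        z x xor z y
          ≡⟨ solve 4 (λ a b c d → a :+ b := ((a :+ c) :+ (b :+ d)) :+ (c :+ d)) refl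
               (z x) (z y) (part x) (part y) ⟩
        (residue x xor residue y) xor (part x xor part y)
          ≡⟨ cong (λ r → (residue x xor r) xor (part x xor part y))
               (residue-constant w 0F (partner t 0F)) ⟩
        (residue x xor residue x) xor (part x xor part y)
          ≡⟨ cong (_xor (part x xor part y)) (xor-same (residue x)) ⟩
        part x xor part y
          ≡⟨ ∑-distrib-+ (λ u → coefficient u ∧ half u x) (λ u → coefficient u ∧ half u y) ⟨
        sum (λ u → (coefficient u ∧ half u x) xor (coefficient u ∧ half u y))
          ≡⟨ sum-cong-≗ (λ u → ∧-distribˡ-xor (coefficient u) (half u x) (half u y)) ⟨
        sum (λ u → coefficient u ∧ cut (half u) w t) ∎
        where
        open ≡-Reasoning
        open xor-∧-Solver using (solve; _:=_; _:+_)
        x y : HalfEdge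
        x = w , 0F
        y = w , partner t 0F
        part : HalfEdge → Bool
        part h = sum (λ u → coefficient u ∧ half u h)

-- The product formula

corollary20 : (F : FourRegularMultigraph) (C C′ P : CircuitPartition F) →
    IsEulerSystem F C → IsEulerSystem F C′ →
    (∀ v → C v ≡ C′ v → P v ≡ C v) →
    (∀ v → C v ≢ C′ v → P v ≢ C v × P v ≢ C′ v) →
    relativeInterlacementMatrix F P C
    ≋ relativeInterlacementMatrix F C′ C ⊗ relativeInterlacementMatrix F P C′
corollary20 F C C′ P euler euler′ same third v w = by-cases (C v ≟ᵀ C′ v)
  where
  open ≡-Reasoning
  open Walks F C using (splits⇒cycle)
  module E  = EulerSystem F C  euler
  module E′ = EulerSystem F C′ euler′

  A B : Matrix (FourRegularMultigraph.order F)
  A = relativeInterlacementMatrix F C′ C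
  B = relativeInterlacementMatrix F P C′

  by-cases : Dec (C v ≡ C′ v) → relativeInterlacementMatrix F P C v w ≡ (A ⊗ B) v w
  by-cases (yes C≡C′) = begin
    relativeInterlacementMatrix F P C v w
      ≡⟨ E.relative-unit-row P v w (same v C≡C′) ⟩
    does (v ≟ᶠ w)
      ≡⟨ E′.relative-unit-row P v w (trans (same v C≡C′) C≡C′) ⟨
    B v w
      ≡⟨ cong (_∧ B v w)
           (trans (E.relative-unit-row C′ v v (sym C≡C′)) (dec-true (v ≟ᶠ v) refl)) ⟨
    A v v ∧ B v w
      ≡⟨ sum-single (λ u → A v u ∧ B u w) v (λ u u≢v → cong (_∧ B u w)
           (trans (E.relative-unit-row C′ v u (sym C≡C′)) (dec-false (v ≟ᶠ u) (u≢v ∘ sym)))) ⟨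
    (A ⊗ B) v w ∎
  by-cases (no C≢C′) = begin
    relativeInterlacementMatrix F P C v w
      ≡⟨ E.relative-row P v w (proj₁ (third v C≢C′)) ⟩
    cut F (E.half v) w (P w)
      ≡⟨ E′.cut-expansion (splits⇒cycle (E.half-splits v)) w (P w) ⟩
    sum (λ u → cut F (E.half v) u (C′ u) ∧ cut F (E′.half u) w (P w))
      ≡⟨ sum-cong-≗ (λ u → term u (C u ≟ᵀ C′ u)) ⟩
    (A ⊗ B) v w ∎
    where
    term : ∀ u → Dec (C u ≡ C′ u) →
           cut F (E.half v) u (C′ u) ∧ cut F (E′.half u) w (P w) ≡ A v u ∧ B u w
    term u (no C≢C′ᵤ) = sym (cong₂ _∧_ (E.relative-row C′ v u (C≢C′ ∘ sym))
      (E′.relative-row P u w (proj₂ (third u C≢C′ᵤ))))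
    term u (yes C≡C′ᵤ) = trans (cong (_∧ cut F (E′.half u) w (P w)) zero-cut)
      (sym (cong (_∧ B u w) (trans (E.relative-row C′ v u (C≢C′ ∘ sym)) zero-cut)))
      where
      -- C′ u is C u, and u is not v, as C and C′ differ at v.
      zero-cut : cut F (E.half v) u (C′ u) ≡ false
      zero-cut = trans (cong (cut F (E.half v) u) (sym C≡C′ᵤ))
        (E.cut-away v u λ { refl → C≢C′ C≡C′ᵤ })
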